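{- Let $T$ be a tree (with at least two vertices). Then $Z(T)=sdim(T)$ if and only if for every pair of distinct major vertices $v_i, v_j$ of $T$, the $v_i$–$v_j$ path in $T$ contains an interior degree two vertex.
   Context: All graphs are finite, simple, undirected and connected with at least two vertices. Zero forcing: color each vertex black or white, with $S$ the initial set of black vertices; the color-change rule turns a white vertex $u_2$ black if it is the only white neighbor of some black vertex. $S$ is a zero forcing set if repeated application eventually makes all vertices black; $Z(G)$ is the minimum size of a zero forcing set. A vertex $x$ strongly resolves $u,v$ if $u$ lies on some shortest $x$–$v$ path or $v$ lies on some shortest $x$–$u$ path; $W$ is a strong resolving set if every pair of distinct vertices is strongly resolved by some vertex of $W$; $sdim(G)$ is the minimum size of a strong resolving set. A major vertex is a vertex of degree at least $3$. A leaf $u$ is a terminal vertex of a major vertex $v$ if $d(u,v)<d(u,w)$ for every other major vertex $w$. An interior degree two vertex is a vertex $z$ of degree $2$ such that a shortest path from $z$ to any terminal vertex contains a major vertex. -}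

module Defs where

open import Data.Nat using (ℕ; zero; suc; _≤_; _<_; _+_)
open import Data.Bool using (Bool; true; false)
open import Data.Fin using (Fin)
open import Data.Fin.Subset using (Subset; _∈_; _∉_; _∪_; ⁅_⁆; ⊤; ∣_∣)
open import Data.Vec using (tabulate)
open import Data.List using (List; []; _∷_; length)
open import Data.List.Relation.Unary.Unique.Propositional using (Unique)
import Data.List.Membership.Propositional as LM
open import Data.Product using (Σ; ∃; ∃-syntax; _×_; _,_)
open import Data.Sum using (_⊎_)
open import Relation.Nullary using (¬_)
open import Relation.Binary.PropositionalEquality using (_≡_; _≢_)
open import Relation.Binary.Construct.Closure.ReflexiveTransitive using (Star)

record Graph (n : ℕ) : Set where
  field
    E     : Fin n → Fin n → Bool
    sym   : ∀ u v → E u v ≡ E v u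
    irrefl : ∀ u → E u u ≡ false

module _ {n : ℕ} (G : Graph n) where
  open Graph G

  Adj : Fin n → Fin n → Set
  Adj u v = E u v ≡ true

  N : Fin n → Subset n
  N v = tabulate (E v)

  deg : Fin n → ℕ
  deg v = ∣ N v ∣

  data Walk : Fin n → Fin n → Set where
    [] : ∀ {u} → Walk u u
    _∷_ : ∀ {u v w} → Adj u v → Walk v w → Walk u w

  len : ∀ {u v} → Walk u v → ℕ
  len [] = 0
  len (_ ∷ p) = suc (len p)

  verts : ∀ {u v} → Walk u v → List (Fin n)
  verts {u} [] = u ∷ []
  verts {u} (_ ∷ p) = u ∷ verts p

  OnWalk : ∀ {u v} → Fin n → Walk u v → Set
  OnWalk x p = x LM.∈ verts p

  IsPath : ∀ {u v} → Walk u v → Set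
  IsPath p = Unique (verts p)

  Connected : Set
  Connected = ∀ u v → Walk u v

  -- a tree: connected, and any two paths between the same endpoints coincide
  -- (equivalently: connected and acyclic)
  IsTree : Set
  IsTree = Connected ×
           (∀ u v (p q : Walk u v) → IsPath p → IsPath q → verts p ≡ verts q)

  Dist : Fin n → Fin n → ℕ → Set
  Dist u v k = (Σ (Walk u v) λ p → len p ≡ k) × (∀ (p : Walk u v) → k ≤ len p)

  -- shortest u–v walk (automatically a path)
  IsShortest : ∀ {u v} → Walk u v → Set
  IsShortest {u} {v} p = Dist u v (len p)

  Major : Fin n → Set
  Major v = 3 ≤ deg v

  Leaf : Fin n → Set
  Leaf u = deg u ≡ 1

  TerminalOf : Fin n → Fin n → Set
  TerminalOf u v = Leaf u × Major v ×
    (∀ w → Major w → w ≢ v → ∀ a b → Dist u v a → Dist u w b → a < b)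

  Terminal : Fin n → Set
  Terminal u = ∃[ v ] TerminalOf u v

  InteriorDeg2 : Fin n → Set
  InteriorDeg2 z = deg z ≡ 2 ×
    (∀ t → Terminal t → ∀ (p : Walk z t) → IsShortest p →
       ∃[ m ] (Major m × OnWalk m p))

  ForceStep : Subset n → Subset n → Set
  ForceStep B B' = ∃[ v ] ∃[ u ] (v ∈ B × u ∉ B × Adj v u ×
    (∀ w → Adj v w → w ≢ u → w ∈ B) × B' ≡ B ∪ ⁅ u ⁆)

  IsZeroForcingSet : Subset n → Set
  IsZeroForcingSet S = Star ForceStep S ⊤

  IsZ : ℕ → Set
  IsZ k = (∃[ S ] (IsZeroForcingSet S × ∣ S ∣ ≡ k)) ×
          (∀ S → IsZeroForcingSet S → k ≤ ∣ S ∣)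

  StronglyResolves : Fin n → Fin n → Fin n → Set
  StronglyResolves x u v =
    (∃[ p ] (IsShortest {x} {v} p × OnWalk u p)) ⊎
    (∃[ p ] (IsShortest {x} {u} p × OnWalk v p))

  IsStrongResolvingSet : Subset n → Set
  IsStrongResolvingSet W =
    ∀ u v → u ≢ v → ∃[ x ] (x ∈ W × StronglyResolves x u v)

  IsSdim : ℕ → Set
  IsSdim k = (∃[ W ] (IsStrongResolvingSet W × ∣ W ∣ ≡ k)) ×
             (∀ W → IsStrongResolvingSet W → k ≤ ∣ W ∣)

  ZEqSdim : Set
  ZEqSdim = ∀ a b → IsZ a → IsSdim b → a ≡ b

{-# OPTIONS --safe #-}
module Submission where

-- Root the tree at a leaf, so that the childless vertices are all leaves but one; let K be
-- their number. A leaf is strongly resolved from another one only by one of the two, so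
-- sdim(T) = K. The childless vertices force everything upwards, so Z(T) ≤ K.
-- A degree two vertex lying between two major vertices is automatically interior, so the
-- condition says exactly that no two major vertices are adjacent. If two of them are adjacent,
-- one childless vertex below the lower one can be dropped from the zero forcing set. If none
-- are, the forces of any zero forcing set S inject into the vertices with a child, that is
-- n - |S| ≤ n - K.

open import Defs
open import Data.Bool using (true; false)
import Data.Bool.Properties as Bool
open import Data.Nat using (ℕ; zero; suc; _≤_; _<_; z≤n; s≤s; _∸_; _⊔_)
open import Data.Nat.Properties
  using (≤-refl; ≤-reflexive; ≤-trans; ≤-antisym; ≤-total; <⇒≤; <-irrefl; <-≤-trans;
         m≤n⇒m≤1+n; n≮n; ≰⇒>; ≮⇒≥; _≤?_;
         suc-injective; ∸-monoʳ-<; ∸-cancelʳ-≤; m≤m⊔n; m≤n⊔m)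
open import Data.Nat.Induction using (<-wellFounded)
open import Data.Fin using (Fin; zero; suc)
open import Data.Fin.Properties as Fin using (_≟_; any?; all?)
open import Data.Fin.Subset using (Subset; _∈_; _∉_; _⊆_; _⊃_; _∪_; ⁅_⁆; ⊤; ∁; ∣_∣; _-_)
open import Data.Fin.Subset.Properties
  using (_∈?_; ∈⊤; ∣⊤∣≡n; ∣p∣≤n; ∣∁p∣≡n∸∣p∣; x∈⁅x⁆; x∈⁅y⁆⇒x≡y;
         p⊆p∪q; q⊆p∪q; x∈p∪q⁻; x∈p∧x≢y⇒x∈p-y; x∈p⇒∣p-x∣<∣p∣;
         x∈∁p⇒x∉p; x∉p⇒x∈∁p; ⊆-antisym; ⊆⊤; p⊆q⇒∣p∣≤∣q∣)
open import Data.Fin.Subset.Induction using (⊃-wellFounded)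
open import Data.List using (List; []; _∷_; length)
import Data.List.Membership.Propositional as List
import Data.List.Membership.DecPropositional as DecMembership
open import Data.List.Relation.Unary.All using ([]; _∷_)
open import Data.List.Relation.Unary.All.Properties using (¬Any⇒All¬; All¬⇒¬Any)
open import Data.List.Relation.Unary.AllPairs using ([]; _∷_)
open import Data.List.Relation.Unary.Any using (here; there)
open import Data.Product using (∃; _×_; _,_; proj₁; proj₂; ∃-syntax)
open import Data.Sum using (_⊎_; inj₁; inj₂; [_,_]′)
open import Data.Unit using (tt) renaming (⊤ to Unit)
open import Data.Vec using (Vec; []; _∷_; tabulate; lookup)
open import Data.Vec.Base using (here; there)
open import Data.Vec.Properties using (lookup∘tabulate; lookup⇒[]=; []=⇒lookup)
open import Function using (_∘_; id)
open import Function.Bundles using (_⇔_; mk⇔)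
open import Induction.WellFounded using (Acc; acc)
open import Relation.Binary.Construct.Closure.ReflexiveTransitive using (Star; ε; _◅_)
open import Relation.Binary.PropositionalEquality
  using (_≡_; _≢_; refl; sym; trans; cong; subst; subst₂; ≢-sym)
open import Relation.Nullary using (¬_; Dec; yes; no; does; contradiction)
open import Relation.Nullary.Decidable using (dec-true; decidable-stable; ¬?; _×-dec_; _→-dec_)
open import Relation.Unary using (Decidable)

-- Finite sets

∈-tabulate⁺ : ∀ {n} f {x : Fin n} → f x ≡ true → x ∈ tabulate f
∈-tabulate⁺ f {x} fx = lookup⇒[]= x (tabulate f) (trans (lookup∘tabulate f x) fx)

∈-tabulate⁻ : ∀ {n} f {x : Fin n} → x ∈ tabulate f → f x ≡ true
∈-tabulate⁻ f {x} x∈ = trans (sym (lookup∘tabulate f x)) ([]=⇒lookup x∈)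

module _ {n} {P : Fin n → Set} (P? : Decidable P) where

  filter : Subset n
  filter = tabulate (does ∘ P?)

  ∈-filter⁺ : ∀ {x} → P x → x ∈ filter
  ∈-filter⁺ {x} px = ∈-tabulate⁺ (does ∘ P?) (dec-true (P? x) px)

  ∈-filter⁻ : ∀ {x} → x ∈ filter → P x
  ∈-filter⁻ {x} x∈ with P? x | ∈-tabulate⁻ (does ∘ P?) x∈
  ... | yes px | _  = px
  ... | no _   | ()

-- The partner of the first element is deleted from `B`; injectivity keeps the other partners away
-- from it. A relation instead of a function lets partners be described by cases.
∣∣-mono-injection : ∀ {m n} (A : Subset m) (B : Subset n) (R : Fin m → Fin n → Set) →
  (∀ {u} → u ∈ A → ∃[ w ] (w ∈ B × R u w)) →
  (∀ {u u′ w} → u ∈ A → u′ ∈ A → R u w → R u′ w → u ≡ u′) →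
  ∣ A ∣ ≤ ∣ B ∣
∣∣-mono-injection [] B R total inj = z≤n
∣∣-mono-injection (false ∷ A) B R total inj =
  ∣∣-mono-injection A B (R ∘ suc) (total ∘ there)
    λ i j r s → Fin.suc-injective (inj (there i) (there j) r s)
∣∣-mono-injection (true ∷ A) B R total inj with total here
... | w , w∈B , r₀ = ≤-trans
  (s≤s (∣∣-mono-injection A (B - w) (R ∘ suc) total′
    λ i j r s → Fin.suc-injective (inj (there i) (there j) r s)))
  (x∈p⇒∣p-x∣<∣p∣ w∈B)
  where
  total′ : ∀ {u} → u ∈ A → ∃[ w′ ] (w′ ∈ B - w × R (suc u) w′)
  total′ u∈ with total (there u∈)
  ... | w′ , w′∈B , r = w′ , x∈p∧x≢y⇒x∈p-y w′∈B w′≢w , r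
    where
    w′≢w : w′ ≢ w
    w′≢w refl with inj here (there u∈) r₀ r
    ... | ()

∃-fresh : ∀ {n k} {p : Subset n} (xs : Vec (Fin n) k) → k < ∣ p ∣ →
  ∃[ z ] (z ∈ p × (∀ i → z ≢ lookup xs i))
∃-fresh {n} {k} {p} xs k<p
  with any? (λ z → z ∈? p ×-dec all? (λ i → ¬? (z ≟ lookup xs i)))
... | yes w = w
... | no none = contradiction (<-≤-trans k<p (subst (∣ p ∣ ≤_) (∣⊤∣≡n k) p≤k)) (<-irrefl refl)
  where
  listed : ∀ {z} → z ∈ p → ∃[ i ] (i ∈ ⊤ × z ≡ lookup xs i)
  listed {z} z∈p with any? (λ i → z ≟ lookup xs i)
  ... | yes (i , z≡) = i , ∈⊤ , z≡
  ... | no ¬z = contradiction (z , z∈p , λ i z≡ → ¬z (i , z≡)) none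
  p≤k : ∣ p ∣ ≤ ∣ ⊤ {k} ∣
  p≤k = ∣∣-mono-injection p ⊤ (λ z i → z ≡ lookup xs i) listed
          λ _ _ z≡ z′≡ → trans z≡ (sym z′≡)

∣∣≥2 : ∀ {n} {p : Subset n} {x y} → x ∈ p → y ∈ p → y ≢ x → 2 ≤ ∣ p ∣
∣∣≥2 x∈ y∈ y≢x =
  ≤-trans (s≤s (≤-trans (s≤s z≤n) (x∈p⇒∣p-x∣<∣p∣ (x∈p∧x≢y⇒x∈p-y y∈ y≢x)))) (x∈p⇒∣p-x∣<∣p∣ x∈)

∣∣≥3 : ∀ {n} {p : Subset n} {x y z} → x ∈ p → y ∈ p → z ∈ p →
  y ≢ x → z ≢ x → z ≢ y → 3 ≤ ∣ p ∣
∣∣≥3 x∈ y∈ z∈ y≢x z≢x z≢y =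
  ≤-trans (s≤s (∣∣≥2 (x∈p∧x≢y⇒x∈p-y y∈ y≢x) (x∈p∧x≢y⇒x∈p-y z∈ z≢x) z≢y)) (x∈p⇒∣p-x∣<∣p∣ x∈)

bounded : ∀ {n} (f : Fin n → ℕ) → ∃[ M ] (∀ x → f x ≤ M)
bounded {zero} f = 0 , λ ()
bounded {suc n} f with bounded (f ∘ suc)
... | M , f≤M = f zero ⊔ M , λ
  { zero → m≤m⊔n (f zero) M ; (suc x) → ≤-trans (f≤M x) (m≤n⊔m (f zero) M) }

-- Walks and degrees

module _ {n} (G : Graph n) where

  open DecMembership (_≟_ {n}) using () renaming (_∈?_ to _∈ˡ?_)

  adj-sym : ∀ {u v} → Adj G u v → Adj G v u
  adj-sym {u} {v} e = trans (sym (Graph.sym G u v)) e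

  adj-irrefl : ∀ {u} → ¬ Adj G u u
  adj-irrefl {u} e with trans (sym e) (Graph.irrefl G u)
  ... | ()

  adj? : ∀ u v → Dec (Adj G u v)
  adj? u v = Graph.E G u v Bool.≟ true

  adj⇒∈N : ∀ {u v} → Adj G u v → v ∈ N G u
  adj⇒∈N {u} = ∈-tabulate⁺ (Graph.E G u)

  ∈N⇒adj : ∀ {u v} → v ∈ N G u → Adj G u v
  ∈N⇒adj {u} = ∈-tabulate⁻ (Graph.E G u)

  major : ∀ {v x y z} → Adj G v x → Adj G v y → Adj G v z →
    y ≢ x → z ≢ x → z ≢ y → Major G v
  major ex ey ez = ∣∣≥3 (adj⇒∈N ex) (adj⇒∈N ey) (adj⇒∈N ez)

  SeparatedMajors : Set
  SeparatedMajors = ∀ {u v} → Adj G u v → Major G u → ¬ Major G v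

  start∈verts : ∀ {u v} (p : Walk G u v) → OnWalk G u p
  start∈verts [] = here refl
  start∈verts (_ ∷ _) = here refl

  end∈verts : ∀ {u v} (p : Walk G u v) → OnWalk G v p
  end∈verts [] = here refl
  end∈verts (_ ∷ p) = there (end∈verts p)

  length-verts : ∀ {u v} (p : Walk G u v) → length (verts G p) ≡ suc (len G p)
  length-verts [] = refl
  length-verts (_ ∷ p) = cong suc (length-verts p)

  dropTo : ∀ {u v x} (p : Walk G u v) → OnWalk G x p →
    ∃[ q ] (len G {x} {v} q ≤ len G p × (IsPath G p → IsPath G q) ×
            (∀ {y} → OnWalk G y q → OnWalk G y p))
  dropTo [] (here refl) = [] , z≤n , id , id
  dropTo p@(_ ∷ _) (here refl) = p , ≤-refl , id , id
  dropTo (_ ∷ p) (there i) with dropTo p i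
  ... | q , q≤p , path , q⊆p = q , m≤n⇒m≤1+n q≤p , (λ { (_ ∷ up) → path up }) , there ∘ q⊆p

  path-∷ : ∀ {u v w} (e : Adj G u v) {p : Walk G v w} → ¬ OnWalk G u p → IsPath G p →
    IsPath G (e ∷ p)
  path-∷ e u∉p path = ¬Any⇒All¬ _ u∉p ∷ path

  path-head : ∀ {u v w} (e : Adj G u v) (p : Walk G v w) → IsPath G (e ∷ p) → ¬ OnWalk G u p
  path-head _ _ (u∉ ∷ _) = All¬⇒¬Any u∉

  path-tail : ∀ {u v w} (e : Adj G u v) (p : Walk G v w) → IsPath G (e ∷ p) → IsPath G p
  path-tail _ _ (_ ∷ path) = path

  toPath : ∀ {u v} (p : Walk G u v) → ∃[ q ] (IsPath G {u} {v} q × len G q ≤ len G p)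
  toPath [] = [] , [] ∷ [] , z≤n
  toPath {u} (e ∷ p) with toPath p
  ... | q , path , q≤p with u ∈ˡ? verts G q
  ...   | no u∉q = e ∷ q , path-∷ e u∉q path , s≤s q≤p
  ...   | yes u∈q with dropTo q u∈q
  ...     | q′ , q′≤q , path′ , _ = q′ , path′ path , m≤n⇒m≤1+n (≤-trans q′≤q q≤p)

  Minimal : ∀ {u v} → Walk G u v → Set
  Minimal {u} {v} p = ∀ (q : Walk G u v) → len G p ≤ len G q

  minimal-tail : ∀ {u v w} (e : Adj G u v) {p : Walk G v w} → Minimal (e ∷ p) → Minimal p
  minimal-tail e min q with min (e ∷ q)
  ... | s≤s p≤q = p≤q

  minimal-no-backtrack : ∀ {u v w x} {e : Adj G u v} {e′ : Adj G v w} {p : Walk G w x} →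
    Minimal (e ∷ e′ ∷ p) → w ≢ u
  minimal-no-backtrack {p = p} min refl = n≮n _ (<⇒≤ (min p))

  -- At most one neighbour, stated without counting so that it follows directly from having no
  -- children.
  Pendant : Fin n → Set
  Pendant v = ∀ {x y} → Adj G v x → Adj G v y → x ≡ y

  -- An inner occurrence of `u` would be entered from and left to its only neighbour, and a shortest
  -- walk does not backtrack.
  pendant-on-minimal : ∀ {x v u} → Pendant u → (p : Walk G x v) → Minimal p → OnWalk G u p →
    u ≡ x ⊎ u ≡ v
  pendant-on-minimal pend [] min (here u≡x) = inj₁ u≡x
  pendant-on-minimal pend (e ∷ p) min (here u≡x) = inj₁ u≡x
  pendant-on-minimal pend (e ∷ p) min (there u∈p)
    with pendant-on-minimal pend p (minimal-tail e min) u∈p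
  pendant-on-minimal pend (e ∷ p) min (there u∈p) | inj₂ u≡v = inj₂ u≡v
  pendant-on-minimal pend (e ∷ []) min (there u∈p) | inj₁ u≡y = inj₂ u≡y
  pendant-on-minimal pend (e ∷ e′ ∷ p) min (there u∈p) | inj₁ refl =
    contradiction (pend e′ (adj-sym e)) (minimal-no-backtrack {e = e} {e′} {p} min)

  -- Zero forcing

  ForceClosed : Subset n → Set
  ForceClosed C = ∀ v u → v ∈ C → Adj G v u → (∀ w → Adj G v w → w ≢ u → w ∈ C) → u ∈ C

  -- Each force strictly enlarges the black set, so forcing until nothing changes terminates.
  force-closure : ∀ B → ∃[ C ] (B ⊆ C × Star (ForceStep G) B C × ForceClosed C)
  force-closure B₀ = go B₀ (⊃-wellFounded B₀)
    where
    go : ∀ B → Acc _⊃_ B → ∃[ C ] (B ⊆ C × Star (ForceStep G) B C × ForceClosed C)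
    go B (acc rec) with any? (λ v → any? (λ u →
      v ∈? B ×-dec ¬? (u ∈? B) ×-dec adj? v u ×-dec
      all? (λ w → adj? v w →-dec (¬? (w ≟ u) →-dec w ∈? B))))
    ... | no stuck = B , id , ε , λ v u v∈B e others →
      decidable-stable (u ∈? B) λ u∉B → stuck (v , u , v∈B , u∉B , e , others)
    ... | yes (v , u , v∈B , u∉B , e , others)
      with go (B ∪ ⁅ u ⁆) (rec (p⊆p∪q ⁅ u ⁆ , u , q⊆p∪q B ⁅ u ⁆ (x∈⁅x⁆ u) , u∉B))
    ...   | C , B′⊆C , steps , closed =
      C , B′⊆C ∘ p⊆p∪q ⁅ u ⁆ , (v , u , v∈B , u∉B , e , others , refl) ◅ steps , closed

  -- Reduces zero forcing to closed supersets of `S`, so that no order of forces has to be chosen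
  -- later.
  closed-total⇒zeroForcing : ∀ {S} →
    (∀ C → S ⊆ C → ForceClosed C → ∀ v → v ∈ C) → IsZeroForcingSet G S
  closed-total⇒zeroForcing {S} total with force-closure S
  ... | C , S⊆C , steps , closed =
    subst (Star (ForceStep G) S) (⊆-antisym ⊆⊤ λ {x} _ → total C S⊆C closed x) steps

  -- The trace of a forcing run: `forcer u` is the vertex that turned `u` black, with arbitrary
  -- values on `S`. Of acyclicity only the case of two vertices forcing each other is recorded.
  record Forcers (S : Subset n) : Set where
    field
      forcer         : Fin n → Fin n
      forcer-adj     : ∀ {u} → u ∉ S → Adj G (forcer u) u
      forcer-inj     : ∀ {u v} → u ∉ S → v ∉ S → forcer u ≡ forcer v → u ≡ v
      forcer-acyclic : ∀ {u v} → u ∉ S → v ∉ S → forcer u ≡ v → forcer v ≢ u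

  forcers : ∀ {S} → IsZeroForcingSet G S → Forcers S
  forcers ε = record
    { forcer = id
    ; forcer-adj = λ u∉ → contradiction ∈⊤ u∉
    ; forcer-inj = λ u∉ → contradiction ∈⊤ u∉
    ; forcer-acyclic = λ u∉ → contradiction ∈⊤ u∉ }
  forcers {S} ((v , u , v∈S , u∉S , e , others , refl) ◅ steps) = record
    { forcer = f ; forcer-adj = f-adj ; forcer-inj = f-inj ; forcer-acyclic = f-acyclic }
    where
    open Forcers (forcers steps)
    stillWhite : ∀ {x} → x ∉ S → x ≢ u → x ∉ S ∪ ⁅ u ⁆
    stillWhite x∉S x≢u x∈ = [ x∉S , x≢u ∘ x∈⁅y⁆⇒x≡y u ]′ (x∈p∪q⁻ S ⁅ u ⁆ x∈)
    f : Fin n → Fin n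
    f x with x ≟ u
    ... | yes _ = v
    ... | no _  = forcer x
    f-adj : ∀ {x} → x ∉ S → Adj G (f x) x
    f-adj {x} x∉ with x ≟ u
    ... | yes refl = e
    ... | no x≢u = forcer-adj (stillWhite x∉ x≢u)
    -- When `v` forces `u`, all its other neighbours are already black, so `v` forces nothing else
    -- later.
    only-u : ∀ {x} → x ∉ S → x ≢ u → forcer x ≢ v
    only-u x∉ x≢u refl = x∉ (others _ (forcer-adj (stillWhite x∉ x≢u)) x≢u)
    f-inj : ∀ {x y} → x ∉ S → y ∉ S → f x ≡ f y → x ≡ y
    f-inj {x} {y} x∉ y∉ eq with x ≟ u | y ≟ u
    ... | yes x≡u | yes y≡u = trans x≡u (sym y≡u)
    ... | yes _   | no y≢u  = contradiction (sym eq) (only-u y∉ y≢u)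
    ... | no x≢u  | yes _   = contradiction eq (only-u x∉ x≢u)
    ... | no x≢u  | no y≢u  = forcer-inj (stillWhite x∉ x≢u) (stillWhite y∉ y≢u) eq
    f-acyclic : ∀ {x y} → x ∉ S → y ∉ S → f x ≡ y → f y ≢ x
    f-acyclic {x} {y} x∉ y∉ eq with x ≟ u | y ≟ u
    -- The forcer `v` of `u` is black at this stage, so it is neither of the two white vertices.
    ... | yes _  | _      = λ _ → y∉ (subst (_∈ S) eq v∈S)
    ... | no _   | yes _  = λ eq′ → x∉ (subst (_∈ S) eq′ v∈S)
    ... | no x≢u | no y≢u = forcer-acyclic (stillWhite x∉ x≢u) (stillWhite y∉ y≢u) eq

  -- Descent on the size of a zero forcing set. The double negation avoids deciding whether a
  -- smaller one exists, and suffices for proving a negation.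
  ¬¬IsZ : ∀ {S} → IsZeroForcingSet G S → ¬ ¬ ∃ (IsZ G)
  ¬¬IsZ {S₀} zfs₀ none = go S₀ zfs₀ (<-wellFounded _)
    where
    go : ∀ S → IsZeroForcingSet G S → ¬ Acc _<_ ∣ S ∣
    go S zfs (acc rec) = none (∣ S ∣ , (S , zfs , refl) , λ S′ zfs′ →
      decidable-stable (∣ S ∣ ≤? ∣ S′ ∣) λ S≰S′ → go S′ zfs′ (rec (≰⇒> S≰S′)))

  IsZ-unique : ∀ {a b} → IsZ G a → IsZ G b → a ≡ b
  IsZ-unique ((S , zS , refl) , minS) ((S′ , zS′ , refl) , minS′) =
    ≤-antisym (minS S′ zS′) (minS′ S zS)

  IsSdim-unique : ∀ {a b} → IsSdim G a → IsSdim G b → a ≡ b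
  IsSdim-unique ((W , rW , refl) , minW) ((W′ , rW′ , refl) , minW′) =
    ≤-antisym (minW W′ rW′) (minW′ W rW)

-- Rooted trees

second : ∀ {A : Set} → A → List A → A
second x (_ ∷ y ∷ _) = y
second x _           = x

module Rooted {n} (T : Graph n) (tree : IsTree T) (r : Fin n) where

  open DecMembership (_≟_ {n}) using () renaming (_∈?_ to _∈ˡ?_)

  toRoot : ∀ v → ∃[ p ] (IsPath T {v} {r} p × len T p ≤ len T (proj₁ tree v r))
  toRoot v = toPath T (proj₁ tree v r)

  depth : Fin n → ℕ
  depth v = len T (proj₁ (toRoot v))

  par : Fin n → Fin n
  par v = second v (verts T (proj₁ (toRoot v)))

  infix 4 _◁_ _⊑_

  -- The first condition excludes the junk value par r ≡ r.
  _◁_ : Fin n → Fin n → Set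
  c ◁ v = c ≢ r × par c ≡ v

  _◁?_ : ∀ c v → Dec (c ◁ v)
  c ◁? v = ¬? (c ≟ r) ×-dec par c ≟ v

  -- By uniqueness of paths, `depth` and `par` can be read off any path to the root, not only the
  -- chosen one.
  toRoot-verts : ∀ {v} (p : Walk T v r) → IsPath T p → verts T (proj₁ (toRoot v)) ≡ verts T p
  toRoot-verts {v} p path = proj₂ tree v r _ p (proj₁ (proj₂ (toRoot v))) path

  toRoot-len : ∀ {v} (p : Walk T v r) → IsPath T p → depth v ≡ len T p
  toRoot-len p path = suc-injective
    (trans (sym (length-verts T (proj₁ (toRoot _))))
      (trans (cong length (toRoot-verts p path)) (length-verts T p)))

  second-verts : ∀ {u v w} (e : Adj T u v) (p : Walk T v w) → second u (verts T (e ∷ p)) ≡ v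
  second-verts e [] = refl
  second-verts e (_ ∷ _) = refl

  path⇒◁ : ∀ {u v} (e : Adj T u v) (p : Walk T v r) → IsPath T (e ∷ p) →
    u ◁ v × depth u ≡ suc (depth v)
  path⇒◁ {u} e p path =
    ((λ { refl → path-head T e p path (end∈verts T p) }) ,
     trans (cong (second u) (toRoot-verts (e ∷ p) path)) (second-verts e p)) ,
    trans (toRoot-len (e ∷ p) path) (cong suc (sym (toRoot-len p (path-tail T e p path))))

  ◁-adj×depth : ∀ {c v} → c ◁ v → Adj T c v × depth c ≡ suc (depth v)
  ◁-adj×depth {c} (c≢r , refl) = go (proj₁ (toRoot c)) (proj₁ (proj₂ (toRoot c)))
    where
    go : (p : Walk T c r) → IsPath T p → Adj T c (par c) × depth c ≡ suc (depth (par c))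
    go [] _ = contradiction refl c≢r
    go (e ∷ p) path with path⇒◁ e p path
    ... | (_ , par≡) , d =
      subst (λ v → Adj T c v × depth c ≡ suc (depth v)) (sym par≡) (e , d)

  ◁-adj : ∀ {c v} → c ◁ v → Adj T c v
  ◁-adj = proj₁ ∘ ◁-adj×depth

  ◁-depth : ∀ {c v} → c ◁ v → depth c ≡ suc (depth v)
  ◁-depth = proj₂ ∘ ◁-adj×depth

  -- If `u` is off the path from `v` to the root, prepending the edge gives the path of `u`.
  -- Otherwise the part of that path from `u` on, preceded by the edge, is the path of `v`.
  adj⇒◁ : ∀ {u v} → Adj T u v → u ◁ v ⊎ v ◁ u
  adj⇒◁ {u} {v} e = go (proj₁ (toRoot v)) (proj₁ (proj₂ (toRoot v)))
    where
    go : (p : Walk T v r) → IsPath T p → u ◁ v ⊎ v ◁ u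
    go p path with u ∈ˡ? verts T p
    ... | no u∉p = inj₁ (proj₁ (path⇒◁ e p (path-∷ T e u∉p path)))
    go [] path | yes (here refl) = contradiction e (adj-irrefl T)
    go (_ ∷ _) path | yes (here refl) = contradiction e (adj-irrefl T)
    go (e′ ∷ p) path | yes (there u∈p) with dropTo T p u∈p
    ... | q , _ , path-q , q⊆p = inj₂ (proj₁ (path⇒◁ (adj-sym T e) q
      (path-∷ T (adj-sym T e) (path-head T e′ p path ∘ q⊆p) (path-q (path-tail T e′ p path)))))

  ◁-asym : ∀ {u v} → u ◁ v → ¬ v ◁ u
  ◁-asym u◁v v◁u = <-irrefl refl (≤-trans
    (m≤n⇒m≤1+n (≤-reflexive (sym (◁-depth v◁u)))) (≤-reflexive (sym (◁-depth u◁v))))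

  -- Childless vertices and descendants

  HasChild : Fin n → Set
  HasChild v = ∃[ c ] c ◁ v

  hasChild? : Decidable HasChild
  hasChild? v = any? (_◁? v)

  childless : Subset n
  childless = filter (¬? ∘ hasChild?)

  ∈-childless⁺ : ∀ {v} → ¬ HasChild v → v ∈ childless
  ∈-childless⁺ = ∈-filter⁺ (¬? ∘ hasChild?)

  ∈-childless⁻ : ∀ {v} → v ∈ childless → ¬ HasChild v
  ∈-childless⁻ = ∈-filter⁻ (¬? ∘ hasChild?)

  parent∈∁childless : ∀ {c v} → c ◁ v → v ∈ ∁ childless
  parent∈∁childless c◁v = x∉p⇒x∈∁p λ v∈ → ∈-childless⁻ v∈ (_ , c◁v)

  childless-pendant : ∀ {v} → ¬ HasChild v → Pendant T v
  childless-pendant ¬c ex ey = trans (sym (up ex)) (up ey)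
    where
    up : ∀ {x} → Adj T _ x → par _ ≡ x
    up e with adj⇒◁ e
    ... | inj₁ (_ , par≡) = par≡
    ... | inj₂ x◁v = contradiction (_ , x◁v) ¬c

  -- The descendant order. Proofs are built from the lower end, so recursion on them climbs along
  -- the unique parents.
  data _⊑_ : Fin n → Fin n → Set where
    refl : ∀ {x} → x ⊑ x
    up   : ∀ {x y v} → x ◁ y → y ⊑ v → x ⊑ v

  ⊑-up : ∀ {x c v} → x ⊑ c → c ◁ v → x ⊑ v
  ⊑-up refl c◁v = up c◁v refl
  ⊑-up (up x◁y y⊑c) c◁v = up x◁y (⊑-up y⊑c c◁v)

  ⊑-depth : ∀ {x v} → x ⊑ v → depth v ≤ depth x
  ⊑-depth refl = ≤-refl
  ⊑-depth (up x◁y y⊑v) =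
    ≤-trans (⊑-depth y⊑v) (<⇒≤ (≤-reflexive (sym (◁-depth x◁y))))

  ⊑-shallow : ∀ {x v} → x ⊑ v → depth x ≤ depth v → x ≡ v
  ⊑-shallow refl _ = refl
  ⊑-shallow (up x◁y y⊑v) x≤v = contradiction
    (≤-trans (≤-reflexive (sym (◁-depth x◁y))) (≤-trans x≤v (⊑-depth y⊑v))) (n≮n _)

  -- The ancestors of `x` form a chain, on which the depth singles out one vertex.
  ⊑-linear : ∀ {x u v} → x ⊑ u → x ⊑ v → depth u ≡ depth v → u ≡ v
  ⊑-linear refl x⊑v d = ⊑-shallow x⊑v (≤-reflexive d)
  ⊑-linear x⊑u refl d = sym (⊑-shallow x⊑u (≤-reflexive (sym d)))
  ⊑-linear (up (_ , refl) y⊑u) (up (_ , refl) y⊑v) d = ⊑-linear y⊑u y⊑v d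

  siblings-disjoint : ∀ {x c c′ v} → x ⊑ c → c ◁ v → c′ ◁ v → c′ ≢ c → ¬ x ⊑ c′
  siblings-disjoint x⊑c c◁v c′◁v c′≢c x⊑c′ =
    c′≢c (⊑-linear x⊑c′ x⊑c (trans (◁-depth c′◁v) (sym (◁-depth c◁v))))

  root-⊑ : ∀ {v} → r ⊑ v → r ≡ v
  root-⊑ refl = refl
  root-⊑ (up (r≢r , _) _) = contradiction refl r≢r

  -- Bottom-up induction: children are deeper, so the gap between the depth and its bound `M`
  -- shrinks.
  child-induction : (P : Fin n → Set) → (∀ v → (∀ {c} → c ◁ v → P c) → P v) → ∀ v → P v
  child-induction P step v = go v (<-wellFounded _)
    where
    M = proj₁ (bounded depth)
    go : ∀ v → Acc _<_ (M ∸ depth v) → P v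
    go v (acc rec) = step v λ {c} c◁v → go c (rec
      (∸-monoʳ-< (≤-reflexive (sym (◁-depth c◁v))) (proj₂ (bounded depth) c)))

  childless-below : ∀ v → ∃[ x ] (x ⊑ v × ¬ HasChild x)
  childless-below = child-induction _ step
    where
    step : ∀ v → (∀ {c} → c ◁ v → ∃[ x ] (x ⊑ c × ¬ HasChild x)) → ∃[ x ] (x ⊑ v × ¬ HasChild x)
    step v ih with hasChild? v
    ... | no ¬c = v , refl , ¬c
    ... | yes (c , c◁v) with ih c◁v
    ...   | x , x⊑c , ¬c = x , ⊑-up x⊑c c◁v , ¬c

  -- The only edge leaving the subtree below `v` joins `v` to its parent; from a vertex strictly
  -- below `v` every step stays inside.
  leaves-subtree-through-root : ∀ {x v u} → x ⊑ v → ¬ u ⊑ v → (p : Walk T x u) → OnWalk T v p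
  leaves-subtree-through-root x⊑v u⋢v [] = contradiction x⊑v u⋢v
  leaves-subtree-through-root refl u⋢v p@(_ ∷ _) = start∈verts T p
  leaves-subtree-through-root (up x◁y y⊑v) u⋢v (e ∷ p) with adj⇒◁ e
  ... | inj₂ z◁x = there (leaves-subtree-through-root (up z◁x (up x◁y y⊑v)) u⋢v p)
  ... | inj₁ (_ , par≡z) = there (leaves-subtree-through-root
    (subst (_⊑ _) (trans (sym (proj₂ x◁y)) par≡z) y⊑v) u⋢v p)

  -- Any competing walk contains a path, which has the same vertices as `p`.
  path⇒shortest : ∀ {u v} (p : Walk T u v) → IsPath T p → IsShortest T p
  path⇒shortest {u} {v} p path = (p , refl) , λ q →
    let q′ , path′ , q′≤q = toPath T q in
    ≤-trans (≤-reflexive (suc-injective (trans (sym (length-verts T p))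
      (trans (cong length (proj₂ tree u v p q′ path path′)) (length-verts T q′))))) q′≤q

  -- Choose `x` below the deeper of the two vertices. The other one is not in that subtree, so the
  -- path from `x` to it passes through the deeper one.
  childless-stronglyResolving : IsStrongResolvingSet T childless
  childless-stronglyResolving u v u≢v with ≤-total (depth u) (depth v)
  ... | inj₁ u≤v =
    let x , x⊑v , ¬c = childless-below v
        p , path , _ = toPath T (proj₁ tree x u)
    in x , ∈-childless⁺ ¬c , inj₂ (p , path⇒shortest p path ,
         leaves-subtree-through-root x⊑v (λ u⊑v → u≢v (⊑-shallow u⊑v u≤v)) p)
  ... | inj₂ v≤u =
    let x , x⊑u , ¬c = childless-below u
        p , path , _ = toPath T (proj₁ tree x v)
    in x , ∈-childless⁺ ¬c , inj₁ (p , path⇒shortest p path ,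
         leaves-subtree-through-root x⊑u (λ v⊑u → u≢v (sym (⊑-shallow v⊑u v≤u))) p)

  -- Forcing along a rooted tree

  module Closed {C : Subset n} (closed : ForceClosed T C) where

    force-parent : ∀ {c v} → c ◁ v → c ∈ C → (∀ {x} → x ◁ c → x ∈ C) → v ∈ C
    force-parent c◁v c∈C below = closed _ _ c∈C (◁-adj c◁v) others
      where
      others : ∀ w → Adj T _ w → w ≢ _ → w ∈ C
      others w e w≢v with adj⇒◁ e
      ... | inj₁ (_ , par≡w) = contradiction (trans (sym par≡w) (proj₂ c◁v)) w≢v
      ... | inj₂ w◁c = below w◁c

    force-child : ∀ {c v} → c ◁ v → v ∈ C → par v ∈ C →
      (∀ {x} → x ◁ v → x ≢ c → x ∈ C) → c ∈ C
    force-child c◁v v∈C par∈C siblings =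
      closed _ _ v∈C (adj-sym T (◁-adj c◁v)) others
      where
      others : ∀ w → Adj T _ w → w ≢ _ → w ∈ C
      others w e w≢c with adj⇒◁ e
      ... | inj₁ (_ , par≡w) = subst (_∈ C) par≡w par∈C
      ... | inj₂ w◁v = siblings w◁v w≢c

    -- Black climbs through a region `P` that contains the children of its members. The induction
    -- also carries the children of `v`, because a child forces its parent only once its own
    -- children are black.
    fill-up : (P : Fin n → Set) → (∀ {c v} → c ◁ v → P v → P c) →
      (∀ {v} → P v → ¬ HasChild v → v ∈ C) → ∀ {v} → P v → v ∈ C
    fill-up P down base {v} = proj₁ (child-induction
      (λ v → (P v → v ∈ C) × (P v → ∀ {c} → c ◁ v → c ∈ C)) step v)
      where
      step : ∀ v → (∀ {c} → c ◁ v → (P c → c ∈ C) × (P c → ∀ {x} → x ◁ c → x ∈ C)) →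
        (P v → v ∈ C) × (P v → ∀ {c} → c ◁ v → c ∈ C)
      step v ih = black , λ pv c◁v → proj₁ (ih c◁v) (down c◁v pv)
        where
        black : P v → v ∈ C
        black pv with hasChild? v
        ... | no ¬c = base pv ¬c
        ... | yes (c , c◁v) =
          force-parent c◁v (proj₁ (ih c◁v) (down c◁v pv)) (proj₂ (ih c◁v) (down c◁v pv))

    childless⊆closed⇒total : childless ⊆ C → ∀ v → v ∈ C
    childless⊆closed⇒total ⊆C v =
      fill-up (λ _ → Unit) (λ _ _ → tt) (λ _ ¬c → ⊆C (∈-childless⁺ ¬c)) {v} tt

  childless-zeroForcing : IsZeroForcingSet T childless
  childless-zeroForcing = closed-total⇒zeroForcing T λ C ⊆C closed →
    Closed.childless⊆closed⇒total closed ⊆C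

  -- A vertex with two children in which one subtree misses x is forced from below; so v and
  -- its parent turn black without the help of x, and then v forces downwards to x.
  childless-minus-zeroForcing : ∀ {x v v₁ v₂ w w₂} → x ⊑ v₁ → ¬ HasChild x →
    v₁ ◁ v → v₂ ◁ v → v₂ ≢ v₁ → v ◁ w → w₂ ◁ w → w₂ ≢ v →
    IsZeroForcingSet T (childless - x)
  childless-minus-zeroForcing {x} {v} {v₁} {v₂} {w} {w₂} x⊑v₁ ¬cx v₁◁v v₂◁v v₂≢v₁ v◁w w₂◁w w₂≢v =
    closed-total⇒zeroForcing T total
    where
    total : ∀ C → childless - x ⊆ C → ForceClosed T C → ∀ y → y ∈ C
    total C ⊆C closed = childless⊆closed⇒total childless⊆C
      where
      open Closed closed
      off-branch : ∀ {y} → ¬ x ⊑ y → y ∈ C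
      off-branch = fill-up (λ y → ¬ x ⊑ y) (λ c◁y x⋢y x⊑c → x⋢y (⊑-up x⊑c c◁y))
        λ x⋢y ¬c → ⊆C (x∈p∧x≢y⇒x∈p-y (∈-childless⁺ ¬c) λ { refl → x⋢y refl })
      from-sibling : ∀ {c c′ u} → x ⊑ c → c ◁ u → c′ ◁ u → c′ ≢ c → u ∈ C
      from-sibling x⊑c c◁u c′◁u c′≢c =
        let x⋢c′ = siblings-disjoint x⊑c c◁u c′◁u c′≢c in
        force-parent c′◁u (off-branch x⋢c′) λ y◁c′ → off-branch λ x⊑y → x⋢c′ (⊑-up x⊑y y◁c′)
      x⊑v : x ⊑ v
      x⊑v = ⊑-up x⊑v₁ v₁◁v
      -- Descent from `v` to `x`. Blackness of the parent is carried along because a vertex forces a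
      -- child only when its own parent is black.
      branch : ∀ {y} → x ⊑ y → y ⊑ v → y ∈ C × par y ∈ C
      branch x⊑y refl = from-sibling x⊑v₁ v₁◁v v₂◁v v₂≢v₁ ,
        subst (_∈ C) (sym (proj₂ v◁w)) (from-sibling x⊑v v◁w w₂◁w w₂≢v)
      branch x⊑y (up y◁z z⊑v) with branch (⊑-up x⊑y y◁z) z⊑v
      ... | z∈C , par∈C =
        force-child y◁z z∈C par∈C (λ s◁z s≢y → off-branch (siblings-disjoint x⊑y y◁z s◁z s≢y)) ,
        subst (_∈ C) (sym (proj₂ y◁z)) z∈C
      childless⊆C : childless ⊆ C
      childless⊆C {y} y∈ with y ≟ x
      ... | yes refl = proj₁ (branch refl x⊑v)
      ... | no y≢x = ⊆C (x∈p∧x≢y⇒x∈p-y y∈ y≢x)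

  -- At most one neighbour is the parent; the fresh choices avoid `par v`.
  major⇒two-children : ∀ {v} → Major T v →
    ∃[ c ] ∃[ c′ ] (c ◁ v × c′ ◁ v × c′ ≢ c)
  major⇒two-children {v} maj =
    let c , c∈ , c≢ = ∃-fresh (par v ∷ []) (<⇒≤ maj)
        c′ , c′∈ , c′≢ = ∃-fresh (par v ∷ c ∷ []) maj
    in c , c′ , child c∈ (c≢ zero) , child c′∈ (c′≢ zero) , c′≢ (suc zero)
    where
    child : ∀ {c} → c ∈ N T v → c ≢ par v → c ◁ v
    child c∈ c≢ with adj⇒◁ (∈N⇒adj T c∈)
    ... | inj₁ (_ , par≡c) = contradiction (sym par≡c) c≢
    ... | inj₂ c◁v = c◁v

  two-children⇒major : ∀ {v c c′} → v ≢ r → c ◁ v → c′ ◁ v → c′ ≢ c → Major T v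
  two-children⇒major {v} v≢r c◁v c′◁v c′≢c =
    major T (◁-adj (v≢r , refl)) (adj-sym T (◁-adj c◁v)) (adj-sym T (◁-adj c′◁v))
      (not-par c◁v) (not-par c′◁v) c′≢c
    where
    not-par : ∀ {c} → c ◁ v → c ≢ par v
    not-par c◁v refl = ◁-asym c◁v (v≢r , refl)

  -- Rooting at a pendant vertex

  module PendantRoot (r-pendant : Pendant T r) {s : Fin n} (r-s : Adj T r s) where

    root-hasChild : HasChild r
    root-hasChild with adj⇒◁ r-s
    ... | inj₁ (r≢r , _) = contradiction refl r≢r
    ... | inj₂ s◁r = s , s◁r

    two-children⇒≢root : ∀ {v c c′} → c ◁ v → c′ ◁ v → c′ ≢ c → v ≢ r
    two-children⇒≢root c◁v c′◁v c′≢c refl =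
      c′≢c (r-pendant (adj-sym T (◁-adj c′◁v)) (adj-sym T (◁-adj c◁v)))

    pendant-resolver : ∀ {x u v} → Pendant T u → Pendant T v → u ≢ v →
      StronglyResolves T x u v → u ≡ x ⊎ v ≡ x
    pendant-resolver pu pv u≢v (inj₁ (p , (_ , min) , u∈p)) with pendant-on-minimal T pu p min u∈p
    ... | inj₁ u≡x = inj₁ u≡x
    ... | inj₂ u≡v = contradiction u≡v u≢v
    pendant-resolver pu pv u≢v (inj₂ (p , (_ , min) , v∈p)) with pendant-on-minimal T pv p min v∈p
    ... | inj₁ v≡x = inj₂ v≡x
    ... | inj₂ v≡u = contradiction (sym v≡u) u≢v

    -- Two pendant vertices are strongly resolved only by one of themselves, so `W` misses at most
    -- one of the childless vertices and the root together.
    sdim-lower-bound : ∀ W → IsStrongResolvingSet T W → ∣ childless ∣ ≤ ∣ W ∣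
    sdim-lower-bound W res with any? (λ u → ¬? (hasChild? u) ×-dec ¬? (u ∈? W))
    ... | no none = p⊆q⇒∣p∣≤∣q∣ {p = childless} {W} λ {u} u∈ →
      decidable-stable (u ∈? W) λ u∉W → none (u , ∈-childless⁻ u∈ , u∉W)
    ... | yes (u , ¬cu , u∉W) = ∣∣-mono-injection childless W R total inj
      where
      -- The missing leaf u is replaced by the root, which is a leaf outside childless.
      R : Fin n → Fin n → Set
      R x y = (x ≡ u × y ≡ r) ⊎ x ≡ y
      other∈W : ∀ {v} → Pendant T v → u ≢ v → v ∈ W
      other∈W pv u≢v with res u _ u≢v
      ... | x , x∈W , sr with pendant-resolver (childless-pendant ¬cu) pv u≢v sr
      ...   | inj₁ refl = contradiction x∈W u∉W
      ...   | inj₂ refl = x∈W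
      total : ∀ {x} → x ∈ childless → ∃[ y ] (y ∈ W × R x y)
      total {x} x∈ with x ≟ u
      ... | yes x≡u = r , other∈W r-pendant (λ { refl → ¬cu root-hasChild }) , inj₁ (x≡u , refl)
      ... | no x≢u = x , other∈W (childless-pendant (∈-childless⁻ x∈)) (≢-sym x≢u) , inj₂ refl
      inj : ∀ {x x′ y} → x ∈ childless → x′ ∈ childless → R x y → R x′ y → x ≡ x′
      inj _ _ (inj₁ (x≡u , _)) (inj₁ (x′≡u , _)) = trans x≡u (sym x′≡u)
      inj _ x′∈ (inj₁ (_ , refl)) (inj₂ refl) = contradiction root-hasChild (∈-childless⁻ x′∈)
      inj x∈ _ (inj₂ refl) (inj₁ (_ , refl)) = contradiction root-hasChild (∈-childless⁻ x∈)
      inj _ _ (inj₂ refl) (inj₂ x′≡y) = sym x′≡y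

    sdim-childless : IsSdim T ∣ childless ∣
    sdim-childless = (childless , childless-stronglyResolving , refl) , sdim-lower-bound

    adjacent-majors⇒smaller-zeroForcing : ∀ {a b} → Adj T a b → Major T a → Major T b →
      ∃[ S ] (IsZeroForcingSet T S × ∣ S ∣ < ∣ childless ∣)
    adjacent-majors⇒smaller-zeroForcing e ma mb =
      [ smaller ma mb , smaller mb ma ]′ (adj⇒◁ e)
      where
      smaller : ∀ {v w} → Major T v → Major T w → v ◁ w →
        ∃[ S ] (IsZeroForcingSet T S × ∣ S ∣ < ∣ childless ∣)
      smaller {v} {w} mv mw v◁w with major⇒two-children mv | major⇒two-children mw
      ... | v₁ , v₂ , v₁◁v , v₂◁v , v₂≢v₁ | w₁ , w₂ , w₁◁w , w₂◁w , w₂≢w₁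
        -- One of `w₁`, `w₂` differs from `v` and serves as its sibling.
        with childless-below v₁ | w₁ ≟ v
      ...   | x , x⊑v₁ , ¬cx | yes refl = childless - x ,
        childless-minus-zeroForcing x⊑v₁ ¬cx v₁◁v v₂◁v v₂≢v₁ v◁w w₂◁w w₂≢w₁ ,
        x∈p⇒∣p-x∣<∣p∣ {p = childless} (∈-childless⁺ ¬cx)
      ...   | x , x⊑v₁ , ¬cx | no w₁≢v = childless - x ,
        childless-minus-zeroForcing x⊑v₁ ¬cx v₁◁v v₂◁v v₂≢v₁ v◁w w₁◁w w₁≢v ,
        x∈p⇒∣p-x∣<∣p∣ {p = childless} (∈-childless⁺ ¬cx)

    -- Charging forces to vertices with a child

    module _ (separated : SeparatedMajors T) where

      module _ {S} (zfs : IsZeroForcingSet T S) where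
        open Forcers (forcers T zfs)

        ForcesChild : Fin n → Set
        ForcesChild v = ∃[ c ] (c ∉ S × c ◁ v × forcer c ≡ v)

        forcesChild? : Decidable ForcesChild
        forcesChild? v = any? λ c → ¬? (c ∈? S) ×-dec c ◁? v ×-dec forcer c ≟ v

        -- A force along a child edge of w is charged to w. If both a child forces u and u forces
        -- a child, then u is major, so its parent is not, has u as its only child, and the edge
        -- to that parent is unused: there the second charge goes.
        data Charge (u w : Fin n) : Set where
          fromParent : u ◁ w → forcer u ≡ w → Charge u w
          fromChild  : u ≡ w → forcer u ◁ u → ¬ ForcesChild u → Charge u w
          moved      : u ◁ w → (∀ {c} → c ◁ w → c ≡ u) → ForcesChild u → Charge u w

        -- A second child of `par u` would keep `par u` from being the pendant root; having a parent
        -- as well, it would be a major vertex next to the major vertex `u`.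
        only-child : ∀ {u c c′} → c ◁ u → c′ ◁ u → c′ ≢ c → ∀ {x} → x ◁ par u → x ≡ u
        only-child {u} c◁u c′◁u c′≢c {x} x◁w = decidable-stable (x ≟ u) λ x≢u →
          separated (◁-adj u◁w) (two-children⇒major u≢r c◁u c′◁u c′≢c)
            (two-children⇒major (two-children⇒≢root u◁w x◁w x≢u) u◁w x◁w x≢u)
          where
          u≢r = two-children⇒≢root c◁u c′◁u c′≢c
          u◁w : u ◁ par u
          u◁w = u≢r , refl

        charge : ∀ {u} → u ∈ ∁ S → ∃[ w ] (w ∈ ∁ childless × Charge u w)
        charge {u} u∈ with x∈∁p⇒x∉p u∈
        ... | u∉S with adj⇒◁ (forcer-adj u∉S)
        ...   | inj₂ u◁f = forcer u , parent∈∁childless u◁f , fromParent u◁f refl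
        ...   | inj₁ f◁u with forcesChild? u
        ...     | no ¬fc = u , parent∈∁childless f◁u , fromChild refl f◁u ¬fc
        ...     | yes fc@(c , c∉S , c◁u , fc≡u) =
          par u , parent∈∁childless u◁w ,
          moved u◁w (only-child f◁u c◁u c≢f) fc
          where
          -- Otherwise `u` and `c` would force each other; so `u` has two distinct children.
          c≢f : c ≢ forcer u
          c≢f c≡f = forcer-acyclic c∉S u∉S fc≡u (sym c≡f)
          u◁w : u ◁ par u
          u◁w = two-children⇒≢root f◁u c◁u c≢f , refl

        -- Rules out a clash of the own charge of `u` with one moved up from `v`: the only child `v`
        -- already forces `u`, so a child forced by `v` would have to be `u` itself.
        fromChild-moved : ∀ {u v} → u ∉ S → forcer u ◁ u → (∀ {c} → c ◁ u → c ≡ v) →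
          v ◁ u → ¬ ForcesChild v
        fromChild-moved u∉S f◁u only v◁u (c , c∉S , c◁v , fc≡v)
          with forcer-inj c∉S u∉S (trans fc≡v (sym (only f◁u)))
        ... | refl = ◁-asym v◁u c◁v

        charge-inj : ∀ {u u′ w} → u ∈ ∁ S → u′ ∈ ∁ S → Charge u w → Charge u′ w → u ≡ u′
        charge-inj u∈ u′∈ (fromParent _ f) (fromParent _ f′) =
          forcer-inj (x∈∁p⇒x∉p u∈) (x∈∁p⇒x∉p u′∈) (trans f (sym f′))
        -- Here `w` forces its child `u`, while a `fromChild` charge requires that it forces no
        -- child.
        charge-inj u∈ u′∈ (fromParent u◁w f) (fromChild refl _ ¬fc) =
          contradiction (_ , x∈∁p⇒x∉p u∈ , u◁w , f) ¬fc
        charge-inj u∈ u′∈ (fromParent u◁w _) (moved _ only _) = only u◁w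
        charge-inj u∈ u′∈ (fromChild refl _ ¬fc) (fromParent u′◁w f) =
          contradiction (_ , x∈∁p⇒x∉p u′∈ , u′◁w , f) ¬fc
        charge-inj u∈ u′∈ (fromChild refl _ _) (fromChild refl _ _) = refl
        charge-inj u∈ u′∈ (fromChild refl f◁u _) (moved u′◁u only fc) =
          contradiction fc (fromChild-moved (x∈∁p⇒x∉p u∈) f◁u only u′◁u)
        charge-inj u∈ u′∈ (moved _ only _) (fromParent u′◁w _) = sym (only u′◁w)
        charge-inj u∈ u′∈ (moved u◁u′ only fc) (fromChild refl f◁u′ _) =
          contradiction fc (fromChild-moved (x∈∁p⇒x∉p u′∈) f◁u′ only u◁u′)
        charge-inj u∈ u′∈ (moved _ only _) (moved u′◁w _ _) = sym (only u′◁w)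

        Z-lower-bound : ∣ childless ∣ ≤ ∣ S ∣
        Z-lower-bound = ∸-cancelʳ-≤ (∣p∣≤n childless)
          (subst₂ _≤_ (∣∁p∣≡n∸∣p∣ S) (∣∁p∣≡n∸∣p∣ childless)
            (∣∣-mono-injection (∁ S) (∁ childless) Charge charge charge-inj))

      Z-childless : IsZ T ∣ childless ∣
      Z-childless = (childless , childless-zeroForcing , refl) , λ S → Z-lower-bound

-- Major vertices

module _ {n} (G : Graph n) where

  InteriorBetweenMajors : Set
  InteriorBetweenMajors = ∀ (vi vj : Fin n) → Major G vi → Major G vj → vi ≢ vj →
    ∃[ p ] (IsPath G {vi} {vj} p × ∃[ z ] (OnWalk G z p × InteriorDeg2 G z))

  -- Following both walks from their common first edge, either they branch, at a major vertex,
  -- or they stay together up to v: the leaf t cannot come before v.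
  branch-meets-major : ∀ {x y v t} (e : Adj G x y) (p : Walk G y v) (q : Walk G y t) →
    Major G v → Leaf G t → IsPath G (e ∷ p) → Minimal G (e ∷ q) →
    ∃[ m ] (Major G m × OnWalk G m q)
  branch-meets-major e [] q mv lt path min = _ , mv , start∈verts G q
  -- If `t` were reached here, it would have two neighbours on the path to `v`.
  branch-meets-major e (e₁ ∷ p) [] mv lt path min = contradiction
    (subst (2 ≤_) lt (∣∣≥2 (adj⇒∈N G (adj-sym G e)) (adj⇒∈N G e₁)
      λ { refl → path-head G e (e₁ ∷ p) path (there (start∈verts G p)) })) (n≮n 1)
  branch-meets-major e (_∷_ {v = y₁} e₁ p) (_∷_ {v = y₂} e₂ q) mv lt path min with y₂ ≟ y₁
  ... | no y₂≢y₁ = _ , major G (adj-sym G e) e₁ e₂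
    (λ { refl → path-head G e (e₁ ∷ p) path (there (start∈verts G p)) })
    (minimal-no-backtrack G {e = e} {e₂} {q} min) y₂≢y₁ , here refl
  ... | yes refl with branch-meets-major e₁ p q mv lt (path-tail G e (e₁ ∷ p) path)
                        (minimal-tail G e {e₂ ∷ q} min)
  ...   | m , mm , m∈q = m , mm , there m∈q

  module _ (tree : IsTree G) where

    -- The path between adjacent major vertices is a single edge, with no room for a vertex of
    -- degree two.
    interior⇒separated : InteriorBetweenMajors → SeparatedMajors G
    interior⇒separated interior {u} {v} e mu mv
      with interior u v mu mv (λ { refl → adj-irrefl G e })
    ... | p , path , z , z∈p , deg≡2 , _
      with subst (z List.∈_) (proj₂ tree u v p (e ∷ []) path
             (path-∷ G e {[]} (λ { (here refl) → adj-irrefl G e }) ([] ∷ []))) z∈p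
    ... | here refl = n≮n 2 (subst (3 ≤_) deg≡2 mu)
    ... | there (here refl) = n≮n 2 (subst (3 ≤_) deg≡2 mv)

    -- The witness is the neighbour `w` of `vi` on the path: it is not major, so its two path
    -- neighbours are all it has. A walk leaving `w` meets `vi` at once or sets out towards `vj`.
    separated⇒interior : SeparatedMajors G → InteriorBetweenMajors
    separated⇒interior separated vi vj mi mj vi≢vj with toPath G (proj₁ tree vi vj)
    ... | [] , _ = contradiction refl vi≢vj
    ... | e ∷ [] , _ = contradiction mj (separated e mi)
    ... | walk@(_∷_ {v = w} e (_∷_ {v = y} e₁ p)) , path , _ =
      walk , path , w , there (here refl) , deg≡2 , meets
      where
      y≢vi : y ≢ vi
      y≢vi refl = path-head G e (e₁ ∷ p) path (there (start∈verts G p))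
      ¬major-w : ¬ Major G w
      ¬major-w = separated e mi
      deg≡2 : deg G w ≡ 2
      deg≡2 = ≤-antisym (≮⇒≥ ¬major-w) (∣∣≥2 (adj⇒∈N G (adj-sym G e)) (adj⇒∈N G e₁) y≢vi)
      meets : ∀ t → Terminal G t → ∀ (q : Walk G w t) → IsShortest G q →
        ∃[ m ] (Major G m × OnWalk G m q)
      meets t (_ , leaf , _) [] _ = contradiction (trans (sym deg≡2) leaf) λ ()
      meets t (_ , leaf , _) (_∷_ {v = y′} e₂ q) (_ , min) with y′ ≟ vi | y′ ≟ y
      ... | yes refl | _ = vi , mi , there (start∈verts G q)
      ... | no y′≢vi | no y′≢y =
        contradiction (major G (adj-sym G e) e₁ e₂ y≢vi y′≢vi y′≢y) ¬major-w
      ... | no _ | yes refl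
        with branch-meets-major e₁ p q mj leaf (path-tail G e (e₁ ∷ p) path) min
      ...   | m , mm , m∈q = m , mm , there m∈q

-- Choice of the root and conclusion

pendant-exists : ∀ {n} (T : Graph n) → 2 ≤ n → IsTree T →
  ∃[ r ] (Pendant T r × ∃ (Adj T r))
-- In an auxiliary rooting at `zero`, the root lies below itself only. A childless vertex below
-- `suc zero` is therefore not the root and has its parent as a neighbour.
pendant-exists T (s≤s (s≤s z≤n)) tree with Rooted.childless-below T tree zero (suc zero)
... | x , x⊑1 , ¬c = x , childless-pendant ¬c , par x , ◁-adj (x≢0 , refl)
  where
  open Rooted T tree zero
  x≢0 : x ≢ zero
  x≢0 refl with root-⊑ x⊑1
  ... | ()

theorem2p5 : ∀ (n : ℕ) (T : Graph n) → 2 ≤ n → IsTree T →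
    ZEqSdim T ⇔
    (∀ (vi vj : Fin n) → Major T vi → Major T vj → vi ≢ vj →
    ∃[ p ] (IsPath T {vi} {vj} p × ∃[ z ] (OnWalk T z p × InteriorDeg2 T z)))
theorem2p5 n T 2≤n tree with pendant-exists T 2≤n tree
... | r , pendant , _ , r-s = mk⇔
  (λ eq → separated⇒interior T tree (separated eq))
  λ interior a b za sb →
    trans (IsZ-unique T za (Z-childless (interior⇒separated T tree interior)))
          (IsSdim-unique T sdim-childless sb)
  where
  open Rooted T tree r
  open PendantRoot pendant r-s
  separated : ZEqSdim T → SeparatedMajors T
  separated eq e mu mv =
    let S , zfs , S<K = adjacent-majors⇒smaller-zeroForcing e mu mv in
    -- `ZEqSdim` compares only given values, so one of `Z` must be supplied; the goal is absurdity,
    -- hence existence up to double negation is enough.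
    ¬¬IsZ T zfs λ (k , zk) →
      n≮n _ (≤-trans (s≤s (subst (_≤ ∣ S ∣) (eq k _ zk sdim-childless) (proj₂ zk S zfs))) S<K)
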